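{- (Productivity) Let $\mathcal I$ be an interpretation of a circuit signature $\Sigma$. For every sequential circuit $f\colon m\to n$ and inputs $\overline v\in\mathbf V^m$, there exist $\overline w\in\mathbf V^n$ and a sequential circuit $g\colon m\to n$ such that $\mathrm{reg}(\overline v);f\rightsquigarrow^{*}g;\mathrm{reg}(\overline w)$ by applying the rules (Mealy), (IF) and (Str) once successively, followed by the value rules exhaustively.
   Context: Circuits. A circuit signature $\Sigma$ consists of a finite set $\mathbf V$ of values with a distinguished value $\bullet$, a set $\mathcal P$ of primitive symbols, and functions $\mathrm{dom},\mathrm{cod}\colon\mathcal P\to\mathbb N$. A PROP is a strict symmetric monoidal category with objects $\mathbb N$ and addition as tensor on objects. $\mathbf{CCirc}_\Sigma$ is the PROP freely generated by: $p\colon\mathrm{dom}(p)\to\mathrm{cod}(p)$ for $p\in\mathcal P$, a fork $1\to2$, a join $2\to1$, an introduction $\bullet\colon0\to1$, and an elimination $1\to0$; its morphisms are combinational circuits. $\mathbf{SCirc}_\Sigma$ is the symmetric traced PROP freely generated by these together with a value $v\colon0\to1$ for each $v\in\mathbf V\setminus\{\bullet\}$ and a delay $\delta\colon1\to1$ (the "value" $\bullet$ means the introduction generator); its morphisms are sequential circuits, taken modulo the axioms of symmetric traced monoidal categories. Composition $f;g$ is in diagrammatic order; $\mathrm{Tr}^x$ sends $x+m\to x+n$ to $m\to n$. $\mathrm{fork}_n,\mathrm{join}_n,\mathrm{elim}_n,\bullet_n,\delta_n$ and $\overline v\colon0\to n$ ($\overline v\in\mathbf V^n$) are the wirewise versions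 on $n$ wires; $\mathrm{reg}(\overline v)\coloneqq(\overline v\otimes\delta_n);\mathrm{join}_n\colon n\to n$. An interpretation $\mathcal I$ is a lattice order on $\mathbf V$ with $\bullet$ least (also written $\bot$) and join $\sqcup$, and for each $p\in\mathcal P$ a $\bot$-preserving monotone function $[\![p]\!]\colon\mathbf V^{\mathrm{dom}(p)}\to\mathbf V^{\mathrm{cod}(p)}$. Rules (applied to subcircuits, modulo axioms of symmetric traced monoidal categories). (Mealy): for combinational $\hat f\colon x+y+z+m\to x+y+n$ and $\overline v\in\mathbf V^z$, a circuit in global trace-delay form $\mathrm{Tr}^{x+y}\big((\mathrm{id}_x\otimes\delta_y\otimes\overline v\otimes\mathrm{id}_m);\hat f\big)$ rewrites to $\mathrm{Tr}^{x+y+z}\big((\mathrm{id}_x\otimes\mathrm{reg}(\bot^y\overline v)\otimes\mathrm{id}_m);\hat f;(\mathrm{id}_{x+y}\otimes\bullet_z\otimes\mathrm{id}_n)\big)$. Every sequential circuit is equal to one in global trace-delay form. (IF): for combinational $h\colon x+a\to x+b$, $\mathrm{Tr}^x(h)\rightsquigarrow h^\dagger;(\mathrm{elim}_x\otimes\mathrm{id}_b)$, where $h^0\coloneqq(\bullet_x\otimes\mathrm{id}_a);h$, $h^{k+1}\coloneqq\mathrm{fork}_a;\big((h^k;(\mathrm{id}_x\otimes\mathrm{elim}_b))\otimes\mathrm{id}_a\big);h$, and $h^\dagger\coloneqq h^{c+1}$ with $c$ the length of the longest chain in $\mathbf V^x$. (Str): for combinational $h\colon a\to b$ and $\overline v\in\mathbf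 V^a$, $\mathrm{reg}(\overline v);h\rightsquigarrow\big((\overline v;h)\otimes(h;\delta_b)\big);\mathrm{join}_b$. Value rules: $v;\mathrm{fork}\rightsquigarrow v\otimes v$; $(v\otimes w);\mathrm{join}\rightsquigarrow v\sqcup w$; $v;\mathrm{elim}\rightsquigarrow\mathrm{id}_0$; $\overline v;p\rightsquigarrow[\![p]\!](\overline v)$ for $p\in\mathcal P$. In the procedure, the value rules are applied exhaustively to the copy $\overline v;h$ produced by (Str). -}

module Defs where

open import Level using (0ℓ)
open import Data.Nat using (ℕ; zero; suc; _+_; _≤_)
open import Data.Nat.Properties using (+-assoc; +-identityʳ)
open import Data.Fin using (Fin) renaming (_<_ to _<ᶠ_)
import Data.Fin.Properties as Fin
open import Data.Product using (Σ; _×_; ∃-syntax)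
open import Data.Vec using (Vec; []; _∷_; _++_; replicate)
open import Data.Vec.Relation.Binary.Pointwise.Inductive using (Pointwise)
open import Function.Bundles using (_↔_)
open import Function.Properties.Inverse using (↔⇒↣)
open import Relation.Nullary using (¬_; yes; no)
open import Relation.Nullary.Decidable using (via-injection)
open import Relation.Binary.Core using (Rel)
open import Relation.Binary.Definitions using (DecidableEquality; Minimum)
open import Relation.Binary.Lattice.Structures using (IsLattice)
open import Relation.Binary.PropositionalEquality
  using (_≡_; _≢_; refl; sym; trans; cong)
open import Relation.Binary.Construct.Closure.ReflexiveTransitive using (Star)

record Signature : Set₁ where
  field
    Value  : Set
    card   : ℕ
    finite : Value ↔ Fin card
    •      : Value
    Prim   : Set
    dom    : Prim → ℕ
    cod    : Prim → ℕ

  infix 4 _≟_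
  _≟_ : DecidableEquality Value
  _≟_ = via-injection (↔⇒↣ finite) Fin._≟_

open Signature public using (Value; Prim; dom; cod)

-- The terms of both free categories.  Kind comb gives the free PROP of
-- combinational circuits, kind seq the free symmetric traced PROP of sequential
-- circuits; in each case the morphisms are terms taken modulo _≈_ below.
data Kind : Set where
  comb seq : Kind

infixr 6 _⨾_
infixr 7 _⊗_

data Circ (S : Signature) : Kind → ℕ → ℕ → Set where
  id    : ∀ {k} n → Circ S k n n
  _⨾_   : ∀ {k l m n} → Circ S k l m → Circ S k m n → Circ S k l n
  _⊗_   : ∀ {k m n p q} → Circ S k m n → Circ S k p q → Circ S k (m + p) (n + q)
  σ     : ∀ {k} m n → Circ S k (m + n) (n + m)

  prim  : ∀ {k} (p : Prim S) → Circ S k (dom S p) (cod S p)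
  fork  : ∀ {k} → Circ S k 1 2
  join  : ∀ {k} → Circ S k 2 1
  intro : ∀ {k} → Circ S k 0 1
  elim  : ∀ {k} → Circ S k 1 0

  -- The proof is irrelevant, so there is one generator for each v ≢ •.
  val   : (v : Value S) → .(v ≢ Signature.• S) → Circ S seq 0 1
  δ     : Circ S seq 1 1
  Tr    : ∀ x {m n} → Circ S seq (x + m) (x + n) → Circ S seq m n

CCirc SCirc : Signature → ℕ → ℕ → Set
CCirc S = Circ S comb
SCirc S = Circ S seq

module _ {S : Signature} where

  -- The identity morphism between two propositionally equal objects.  It is used
  -- wherever strictness of the tensor identifies objects that are not
  -- definitionally equal.
  coe : ∀ {k m n} → m ≡ n → Circ S k m n
  coe {n = n} refl = id n

  infix 4 _≈_

  data _≈_ : ∀ {k m n} → Circ S k m n → Circ S k m n → Set where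
    ≈-refl  : ∀ {k m n} {f : Circ S k m n} → f ≈ f
    ≈-sym   : ∀ {k m n} {f g : Circ S k m n} → f ≈ g → g ≈ f
    ≈-trans : ∀ {k m n} {f g h : Circ S k m n} → f ≈ g → g ≈ h → f ≈ h
    ⨾-cong  : ∀ {k l m n} {f f′ : Circ S k l m} {g g′ : Circ S k m n} →
              f ≈ f′ → g ≈ g′ → f ⨾ g ≈ f′ ⨾ g′
    ⊗-cong  : ∀ {k m n p q} {f f′ : Circ S k m n} {g g′ : Circ S k p q} →
              f ≈ f′ → g ≈ g′ → f ⊗ g ≈ f′ ⊗ g′
    Tr-cong : ∀ {x m n} {f f′ : SCirc S (x + m) (x + n)} →
              f ≈ f′ → Tr x {m} {n} f ≈ Tr x f′

    ⨾-idˡ   : ∀ {k m n} {f : Circ S k m n} → id m ⨾ f ≈ f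
    ⨾-idʳ   : ∀ {k m n} {f : Circ S k m n} → f ⨾ id n ≈ f
    ⨾-assoc : ∀ {k l m n p}
              {f : Circ S k l m} {g : Circ S k m n} {h : Circ S k n p} →
              (f ⨾ g) ⨾ h ≈ f ⨾ (g ⨾ h)

    ⊗-id    : ∀ {k} m n → id {k = k} m ⊗ id n ≈ id (m + n)
    ⊗-⨾     : ∀ {k l m n p q r}
              {f : Circ S k l m} {g : Circ S k m n}
              {h : Circ S k p q} {i : Circ S k q r} →
              (f ⨾ g) ⊗ (h ⨾ i) ≈ (f ⊗ h) ⨾ (g ⊗ i)
    ⊗-unitˡ : ∀ {k m n} {f : Circ S k m n} → id 0 ⊗ f ≈ f
    ⊗-unitʳ : ∀ {k m n} {f : Circ S k m n} →
              (f ⊗ id 0) ⨾ coe (+-identityʳ n) ≈ coe (+-identityʳ m) ⨾ f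
    ⊗-assoc : ∀ {k m n p q r s}
              {f : Circ S k m n} {g : Circ S k p q} {h : Circ S k r s} →
              ((f ⊗ g) ⊗ h) ⨾ coe (+-assoc n q s)
                ≈ coe (+-assoc m p r) ⨾ (f ⊗ (g ⊗ h))

    σ-natural : ∀ {k m n p q} {f : Circ S k m n} {g : Circ S k p q} →
                (f ⊗ g) ⨾ σ n q ≈ σ m p ⨾ (g ⊗ f)
    σ-inverse : ∀ {k} m n → σ {k = k} m n ⨾ σ n m ≈ id (m + n)
    σ-hexagon : ∀ {k} m n p →
                σ {k = k} m (n + p)
                  ≈ coe (sym (+-assoc m n p))
                  ⨾ (σ m n ⊗ id p)
                  ⨾ coe (+-assoc n m p)
                  ⨾ (id n ⊗ σ m p)
                  ⨾ coe (sym (+-assoc n p m))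

    tightening  : ∀ {x l m n p}
                  {f : SCirc S l m} {g : SCirc S (x + m) (x + n)} {h : SCirc S n p} →
                  Tr x ((id x ⊗ f) ⨾ g ⨾ (id x ⊗ h)) ≈ f ⨾ Tr x g ⨾ h
    sliding     : ∀ {x y m n} {g : SCirc S (x + m) (y + n)} {h : SCirc S y x} →
                  Tr x {m} {n} (g ⨾ (h ⊗ id n)) ≈ Tr y ((h ⊗ id m) ⨾ g)
    vanishing-0 : ∀ {m n} {f : SCirc S m n} → Tr 0 f ≈ f
    vanishing-+ : ∀ {x y m n} {f : SCirc S ((x + y) + m) ((x + y) + n)} →
                  Tr (x + y) {m} {n} f
                    ≈ Tr y (Tr x (coe (sym (+-assoc x y m)) ⨾ f ⨾ coe (+-assoc x y n)))
    superposing : ∀ {x m n p q} {f : SCirc S (x + m) (x + n)} {g : SCirc S p q} →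
                  Tr x f ⊗ g
                    ≈ Tr x (coe (sym (+-assoc x m p)) ⨾ (f ⊗ g) ⨾ coe (+-assoc x n q))
    yanking     : ∀ x → Tr x (σ x x) ≈ id x

  -- The functor from combinational to sequential circuits.
  ι : ∀ {m n} → CCirc S m n → SCirc S m n
  ι (id n)   = id n
  ι (f ⨾ g)  = ι f ⨾ ι g
  ι (f ⊗ g)  = ι f ⊗ ι g
  ι (σ m n)  = σ m n
  ι (prim p) = prim p
  ι fork     = fork
  ι join     = join
  ι intro    = intro
  ι elim     = elim

  value : Value S → SCirc S 0 1
  value v with Signature._≟_ S v (Signature.• S)
  ... | yes _  = intro
  ... | no v≢• = val v v≢•

  forks : ∀ {k} n → Circ S k n (n + n)
  forks zero    = id 0
  forks (suc n) = (fork ⊗ forks n)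
                ⨾ (id 1 ⊗ (σ 1 n ⊗ id n))
                ⨾ (id 1 ⊗ coe (+-assoc n 1 n))

  joins : ∀ {k} n → Circ S k (n + n) n
  joins zero    = id 0
  joins (suc n) = (id 1 ⊗ coe (sym (+-assoc n 1 n)))
                ⨾ (id 1 ⊗ (σ n 1 ⊗ id n))
                ⨾ (join ⊗ joins n)

  intros : ∀ {k} n → Circ S k 0 n
  intros zero    = id 0
  intros (suc n) = intro ⊗ intros n

  elims : ∀ {k} n → Circ S k n 0
  elims zero    = id 0
  elims (suc n) = elim ⊗ elims n

  δs : ∀ n → SCirc S n n
  δs zero    = id 0
  δs (suc n) = δ ⊗ δs n

  values : ∀ {n} → Vec (Value S) n → SCirc S 0 n
  values []       = id 0
  values (v ∷ vs) = value v ⊗ values vs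

  reg : ∀ {n} → Vec (Value S) n → SCirc S n n
  reg {n} vs = (values vs ⊗ δs n) ⨾ joins n

  -- iterate h k and the circuit h† built from it take the feedback of h on its
  -- first x wires.
  iterate : ∀ x {a b} → CCirc S (x + a) (x + b) → ℕ → CCirc S a (x + b)
  iterate x {a} {b} h zero    = (intros x ⊗ id a) ⨾ h
  iterate x {a} {b} h (suc k) =
    forks a ⨾ ((iterate x h k ⨾ (id x ⊗ elims b) ⨾ coe (+-identityʳ x)) ⊗ id a) ⨾ h

  data Context (a b : ℕ) : ℕ → ℕ → Set where
    □    : Context a b a b
    _⨾ˡ_ : ∀ {l m n} → Context a b l m → SCirc S m n → Context a b l n
    _⨾ʳ_ : ∀ {l m n} → SCirc S l m → Context a b m n → Context a b l n
    _⊗ˡ_ : ∀ {m n p q} → Context a b m n → SCirc S p q → Context a b (m + p) (n + q)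
    _⊗ʳ_ : ∀ {m n p q} → SCirc S m n → Context a b p q → Context a b (m + p) (n + q)
    Tr   : ∀ x {m n} → Context a b (x + m) (x + n) → Context a b m n

  _[_] : ∀ {a b m n} → Context a b m n → SCirc S a b → SCirc S m n
  □        [ f ] = f
  (C ⨾ˡ g) [ f ] = C [ f ] ⨾ g
  (g ⨾ʳ C) [ f ] = g ⨾ C [ f ]
  (C ⊗ˡ g) [ f ] = C [ f ] ⊗ g
  (g ⊗ʳ C) [ f ] = g ⊗ C [ f ]
  Tr x C   [ f ] = Tr x (C [ f ])

  Rule : Set₁
  Rule = ∀ {a b} → SCirc S a b → SCirc S a b → Set

  -- One application of a rule to a subcircuit, modulo _≈_.
  Step : Rule → Rule
  Step R s t = ∃[ a ] ∃[ b ] Σ (Context a b _ _) λ C →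
               ∃[ l ] ∃[ r ] (s ≈ C [ l ] × R l r × C [ r ] ≈ t)

  -- The Star relation only identifies syntactically equal terms when no rule is
  -- applied, hence the final equivalence.
  Exhaustively : Rule → Rule
  Exhaustively R s t =
    (∃[ u ] (Star (Step R) s u × u ≈ t)) × (∀ {u} → ¬ Step R t u)

  shuffle : ∀ x y z m → (x + (y + z)) + m ≡ (x + y) + (z + m)
  shuffle x y z m = trans (cong (_+ m) (sym (+-assoc x y z))) (+-assoc (x + y) z m)

  data Mealy : Rule where
    mealy : ∀ x y z {m n} (f̂ : CCirc S ((x + y) + (z + m)) ((x + y) + n))
            (vs : Vec (Value S) z) →
            Mealy (Tr (x + y) (((id x ⊗ δs y) ⊗ (values vs ⊗ id m)) ⨾ ι f̂))
                  (Tr (x + (y + z))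
                    ( ((id x ⊗ reg (replicate y (Signature.• S) ++ vs)) ⊗ id m)
                    ⨾ coe (shuffle x y z m)
                    ⨾ ι f̂
                    ⨾ (id (x + y) ⊗ (intros z ⊗ id n))
                    ⨾ coe (sym (shuffle x y z n)) ))

record Interpretation (S : Signature) : Set₁ where
  open Signature S using (•)
  infix 4 _⊑_ _⊑*_
  infixr 6 _⊔_
  infixr 7 _⊓_
  field
    _⊑_       : Rel (Value S) 0ℓ
    _⊔_       : Value S → Value S → Value S
    _⊓_       : Value S → Value S → Value S
    isLattice : IsLattice _≡_ _⊑_ _⊔_ _⊓_
    minimum   : Minimum _⊑_ •

  _⊑*_ : ∀ {n} → Rel (Vec (Value S) n) 0ℓ
  _⊑*_ = Pointwise _⊑_

  field
    ⟦_⟧        : (p : Prim S) → Vec (Value S) (dom S p) → Vec (Value S) (cod S p)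
    ⊥-preserve : ∀ p → ⟦ p ⟧ (replicate (dom S p) •) ≡ replicate (cod S p) •
    monotone   : ∀ p {us vs} → us ⊑* vs → ⟦ p ⟧ us ⊑* ⟦ p ⟧ vs

  -- A chain of length ℓ has ℓ + 1 elements.
  Chain : ℕ → ℕ → Set
  Chain x ℓ = Σ (Fin (suc ℓ) → Vec (Value S) x) λ c →
              ∀ {i j} → i <ᶠ j → c i ⊑* c j × c i ≢ c j

  LongestChainLength : ℕ → ℕ → Set
  LongestChainLength x c = Chain x c × (∀ {ℓ} → Chain x ℓ → ℓ ≤ c)

module _ {S : Signature} (I : Interpretation S) where
  open Interpretation I

  data IF : Rule {S} where
    if : ∀ x {a b} (h : CCirc S (x + a) (x + b)) {c} → LongestChainLength x c →
         IF (Tr x (ι h)) (ι (iterate x h (suc c) ⨾ (elims x ⊗ id b)))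

  data ValueRule : Rule {S} where
    v-fork : ∀ v → ValueRule (value v ⨾ fork) (value v ⊗ value v)
    v-join : ∀ v w → ValueRule ((value v ⊗ value w) ⨾ join) (value (v ⊔ w))
    v-elim : ∀ v → ValueRule (value v ⨾ elim) (id 0)
    v-prim : ∀ p vs → ValueRule (values vs ⨾ prim p) (values (⟦ p ⟧ vs))

  -- Str l D u: the rule (Str) rewrites l to D [ u ], where u is the copy of the
  -- combinational circuit that receives the stored values.
  data Str : ∀ {a b} → SCirc S a b → Context 0 b a b → SCirc S 0 b → Set where
    str : ∀ {a b} (h : CCirc S a b) (vs : Vec (Value S) a) →
          Str (reg vs ⨾ ι h)
              ((□ ⊗ˡ (ι h ⨾ δs b)) ⨾ˡ joins b)
              (values vs ⨾ ι h)

  -- One application of (Str) to a subcircuit, after which the value rules are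
  -- applied exhaustively to the copy that this application produces.
  record StrThenValues {m n} (s t : SCirc S m n) : Set where
    field
      {a b}      : ℕ
      context    : Context a b m n
      {redex}    : SCirc S a b
      {reduct}   : Context 0 b a b
      {copy}     : SCirc S 0 b
      {normal}   : SCirc S 0 b
      source     : s ≈ context [ redex ]
      rewriting  : Str redex reduct copy
      evaluation : Exhaustively ValueRule copy normal
      target     : context [ reduct [ normal ] ] ≈ t

  Procedure : ∀ {m n} → SCirc S m n → SCirc S m n → Set
  Procedure s t = ∃[ s₁ ] ∃[ s₂ ] (Step Mealy s s₁ × Step IF s₁ s₂ × StrThenValues s₂ t)

{-# OPTIONS --safe #-}
module Submission where

-- Every circuit has a global trace-delay form, by induction: boxes made of wires,
-- delays and values can be gathered in front of a combinational core, and their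
-- order can be changed by sliding.  After (Mealy), the input register joins the
-- state registers in front of a purely combinational loop, which (IF) unrolls to a
-- combinational circuit k.  Pushing the registers through k by (Str) leaves
-- registers behind k; those on the state wires stay in the feedback, and those on
-- the output wires leave it by tightening.

open import Data.Empty using (⊥-elim; ⊥-elim-irr)
open import Data.Fin using (Fin; zero; suc; funToFin; finToFun) renaming (_<_ to _<ᶠ_)
open import Data.Fin.Properties using (all?; any?; finToFun-funToFin; injective⇒≤)
  renaming (_<?_ to _<ᶠ?_; <-cmp to <ᶠ-cmp)
open import Data.Nat using (ℕ; zero; suc; _+_; _^_; _≤_; s≤s⁻¹)
open import Data.Nat.Properties
  using (+-assoc; +-identityʳ; +-comm; +-cancelˡ-≡; +-commutativeSemigroup;
         ≤-refl; ≤-trans; ≤∧≢⇒<; m≤m+n; m≤n+m; n≤1+n; n≮0)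
open import Algebra.Properties.CommutativeSemigroup +-commutativeSemigroup
  using () renaming (interchange to +-interchange)
open import Data.Product using (Σ; _×_; _,_; proj₂; ∃-syntax)
open import Data.Vec using (Vec; []; _∷_; _++_; replicate; lookup; tabulate; take; drop)
open import Data.Vec.Properties using (take++drop≡id; tabulate∘lookup; tabulate-cong; ≡-dec)
open import Data.Vec.Relation.Binary.Pointwise.Inductive using (decidable)
open import Function using (_∘_)
open import Function.Bundles using (Inverse)
open import Relation.Binary.Construct.Closure.ReflexiveTransitive
  using (Star; ε; _◅_; _◅◅_; gmap)
open import Relation.Binary.Definitions using (tri<; tri≈; tri>)
open import Relation.Binary.Lattice.Structures using (IsLattice)
open import Relation.Binary.PropositionalEquality
  using (_≡_; _≢_; refl; sym; trans; cong; cong₂; subst; subst₂)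
open import Relation.Nullary using (¬_; Dec; yes; no)
open import Relation.Nullary.Decidable using (map′; ¬?; _×-dec_; _→-dec_)
open import Defs

-- Two features of working with terms modulo `_≈_` shape the proof. Strictness holds only up to
-- propositional equality of objects, so the axioms carry `coe`; calculations therefore take place
-- in a heterogeneous relation. Exhaustiveness is a negative claim about every term equal to the
-- result, and it is settled by an invariant of `_≈_`, without normal forms for morphisms. (IF) is
-- available only once and needs a combinational body, whereas (Mealy) leaves registers on part of
-- the feedback. The trace is therefore split: the wires without registers form the loop that (IF)
-- removes, and the state wires become additional inputs and outputs of its body. The number of
-- iterations exists because the powers of the value set are finite. The unrolled body is the step
-- function of a Mealy machine: evaluated at the current state and input, it yields the next state
-- and the output, which are the values stored in the two groups of registers behind it.

module _ {S : Signature} where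

  -- Equality across propositionally equal objects

  infix 4 _≋_

  -- Equality of morphisms in the strict category, where propositionally equal
  -- objects are identified; every coe is absorbed.
  data _≋_ {k m n m′ n′} (f : Circ S k m n) (g : Circ S k m′ n′) : Set where
    het : (p : m ≡ m′) (q : n ≡ n′) → f ⨾ coe q ≈ coe p ⨾ g → f ≋ g

  ≈⇒≋ : ∀ {k m n} {f g : Circ S k m n} → f ≈ g → f ≋ g
  ≈⇒≋ e = het refl refl (≈-trans ⨾-idʳ (≈-trans e (≈-sym ⨾-idˡ)))

  ≋⇒≈ : ∀ {k m n} {f g : Circ S k m n} → f ≋ g → f ≈ g
  ≋⇒≈ (het refl refl e) = ≈-trans (≈-sym ⨾-idʳ) (≈-trans e ⨾-idˡ)

  ≋-refl : ∀ {k m n} {f : Circ S k m n} → f ≋ f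
  ≋-refl = ≈⇒≋ ≈-refl

  ≋-sym : ∀ {k m n m′ n′} {f : Circ S k m n} {g : Circ S k m′ n′} → f ≋ g → g ≋ f
  -- Once the object equations are matched with `refl`, both sides have the same type, and the claim
  -- reduces to one about `_≈_`; the congruences below use the same device.
  ≋-sym e@(het refl refl _) = ≈⇒≋ (≈-sym (≋⇒≈ e))

  ≋-trans : ∀ {k m n m′ n′ m″ n″}
            {f : Circ S k m n} {g : Circ S k m′ n′} {h : Circ S k m″ n″} →
            f ≋ g → g ≋ h → f ≋ h
  ≋-trans d@(het refl refl _) e@(het refl refl _) = ≈⇒≋ (≈-trans (≋⇒≈ d) (≋⇒≈ e))

  ⨾-cong≋ : ∀ {k l m n l′ m′ n′}
            {f : Circ S k l m} {g : Circ S k m n}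
            {f′ : Circ S k l′ m′} {g′ : Circ S k m′ n′} →
            f ≋ f′ → g ≋ g′ → f ⨾ g ≋ f′ ⨾ g′
  ⨾-cong≋ d@(het refl refl _) e@(het refl refl _) = ≈⇒≋ (⨾-cong (≋⇒≈ d) (≋⇒≈ e))

  ⊗-cong≋ : ∀ {k m n p q m′ n′ p′ q′}
            {f : Circ S k m n} {g : Circ S k p q}
            {f′ : Circ S k m′ n′} {g′ : Circ S k p′ q′} →
            f ≋ f′ → g ≋ g′ → f ⊗ g ≋ f′ ⊗ g′
  ⊗-cong≋ d@(het refl refl _) e@(het refl refl _) = ≈⇒≋ (⊗-cong (≋⇒≈ d) (≋⇒≈ e))

  -- The object equations inside `≋` concern only the sums, hence the separate premise `x ≡ x′`;
  -- cancelling `x` then recovers the equations between the outer objects.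
  Tr-cong≋ : ∀ {x x′ m n m′ n′}
             {f : SCirc S (x + m) (x + n)} {g : SCirc S (x′ + m′) (x′ + n′)} →
             x ≡ x′ → f ≋ g → Tr x {m} {n} f ≋ Tr x′ {m′} {n′} g
  Tr-cong≋ {x} {m = m} {n} {m′} {n′} refl e@(het p q _)
    with +-cancelˡ-≡ x m m′ p | +-cancelˡ-≡ x n n′ q
  ... | refl | refl = ≈⇒≋ (Tr-cong (≋⇒≈ e))

  infixr 2 _≋⟨_⟩_ _≈⟨_⟩_
  infix 3 _∎

  _≋⟨_⟩_ : ∀ {k m n m′ n′ m″ n″}
           (f : Circ S k m n) {g : Circ S k m′ n′} {h : Circ S k m″ n″} →
           f ≋ g → g ≋ h → f ≋ h
  _ ≋⟨ d ⟩ e = ≋-trans d e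

  _≈⟨_⟩_ : ∀ {k m n m′ n′}
           (f : Circ S k m n) {g : Circ S k m n} {h : Circ S k m′ n′} →
           f ≈ g → g ≋ h → f ≋ h
  _ ≈⟨ d ⟩ e = ≋-trans (≈⇒≋ d) e

  _∎ : ∀ {k m n} (f : Circ S k m n) → f ≋ f
  _ ∎ = ≋-refl

  coe-id : ∀ {k m n} (p : m ≡ n) → coe {k = k} p ≋ id {S} {k} n
  coe-id refl = ≋-refl

  coeˡ : ∀ {k l m n} (p : l ≡ m) {f : Circ S k m n} → coe p ⨾ f ≋ f
  coeˡ refl = ≈⇒≋ ⨾-idˡ

  coeʳ : ∀ {k l m n} {f : Circ S k l m} (p : m ≡ n) → f ⨾ coe p ≋ f
  coeʳ refl = ≈⇒≋ ⨾-idʳ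

  conjugate : ∀ {k l m n o} (p : l ≡ m) {f : Circ S k m n} (q : n ≡ o) →
              coe p ⨾ f ⨾ coe q ≋ f
  conjugate p q = ≋-trans (coeˡ p) (coeʳ q)

  assoc≋ : ∀ {k m n p q r s}
           {f : Circ S k m n} {g : Circ S k p q} {h : Circ S k r s} →
           (f ⊗ g) ⊗ h ≋ f ⊗ (g ⊗ h)
  assoc≋ {m = m} {n} {p} {q} {r} {s} = het (+-assoc m p r) (+-assoc n q s) ⊗-assoc

  unitʳ≋ : ∀ {k m n} {f : Circ S k m n} → f ⊗ id 0 ≋ f
  unitʳ≋ {m = m} {n} = het (+-identityʳ m) (+-identityʳ n) ⊗-unitʳ

  ι-coe : ∀ {m n} (p : m ≡ n) → ι {S} (coe p) ≈ coe p
  ι-coe refl = ≈-refl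

  ι-conjugate : ∀ {l m n o} (p : l ≡ m) {f : CCirc S m n} (q : n ≡ o) →
                ι (coe p ⨾ f ⨾ coe q) ≋ ι f
  ι-conjugate p q = ≋-trans (≈⇒≋ (⨾-cong (ι-coe p) (⨾-cong ≈-refl (ι-coe q)))) (conjugate p q)

  ι-intros : ∀ n → ι {S} (intros n) ≡ intros n
  ι-intros zero    = refl
  ι-intros (suc n) = cong (intro ⊗_) (ι-intros n)

  slice : ∀ {k m n p q} {f : Circ S k m n} {g : Circ S k p q} →
          f ⊗ g ≈ (f ⊗ id p) ⨾ (id n ⊗ g)
  slice = ≈-trans (⊗-cong (≈-sym ⨾-idʳ) (≈-sym ⨾-idˡ)) ⊗-⨾

  slice′ : ∀ {k m n p q} {f : Circ S k m n} {g : Circ S k p q} →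
           f ⊗ g ≈ (id m ⊗ g) ⨾ (f ⊗ id q)
  slice′ = ≈-trans (⊗-cong (≈-sym ⨾-idˡ) (≈-sym ⨾-idʳ)) ⊗-⨾

  ⨾-id⊗ : ∀ {k l m n p} {f : Circ S k l m} {g : Circ S k m n} →
          id p ⊗ (f ⨾ g) ≈ (id p ⊗ f) ⨾ (id p ⊗ g)
  ⨾-id⊗ = ≈-trans (⊗-cong (≈-sym ⨾-idˡ) ≈-refl) ⊗-⨾

  ⨾-⊗id : ∀ {k l m n p} {f : Circ S k l m} {g : Circ S k m n} →
          (f ⨾ g) ⊗ id p ≈ (f ⊗ id p) ⨾ (g ⊗ id p)
  ⨾-⊗id = ≈-trans (⊗-cong ≈-refl (≈-sym ⨾-idˡ)) ⊗-⨾

  -- Symmetry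

  σ-swap : ∀ {k m n p q} {f : Circ S k m n} {g : Circ S k p q} →
           f ⊗ g ≈ σ m p ⨾ (g ⊗ f) ⨾ σ q n
  σ-swap {m = m} {n} {p} {q} {f} {g} = ≋⇒≈ (
    f ⊗ g                          ≈⟨ ≈-sym ⨾-idʳ ⟩
    (f ⊗ g) ⨾ id (n + q)           ≈⟨ ⨾-cong ≈-refl (≈-sym (σ-inverse n q)) ⟩
    (f ⊗ g) ⨾ σ n q ⨾ σ q n        ≈⟨ ≈-sym ⨾-assoc ⟩
    ((f ⊗ g) ⨾ σ n q) ⨾ σ q n      ≈⟨ ⨾-cong σ-natural ≈-refl ⟩
    (σ m p ⨾ (g ⊗ f)) ⨾ σ q n      ≈⟨ ⨾-assoc ⟩
    σ m p ⨾ (g ⊗ f) ⨾ σ q n        ∎)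

  -- The hexagon at n = p = 0 makes σ m 0 idempotent, and it is invertible.
  σ-unitʳ : ∀ {k} m → σ {S} {k} m 0 ≋ id {S} {k} m
  σ-unitʳ {k} m = ≋-sym (
    id m                                          ≈⟨ ≈-sym (σ-inverse 0 m) ⟩
    σ 0 m ⨾ σ m 0                                 ≋⟨ ⨾-cong≋ ≋-refl idempotent ⟩
    σ 0 m ⨾ σ m 0 ⨾ coe m≡m+0 ⨾ σ m 0             ≈⟨ ≈-sym ⨾-assoc ⟩
    (σ 0 m ⨾ σ m 0) ⨾ coe m≡m+0 ⨾ σ m 0           ≈⟨ ⨾-cong (σ-inverse 0 m) ≈-refl ⟩
    id m ⨾ coe m≡m+0 ⨾ σ m 0                      ≈⟨ ⨾-idˡ ⟩
    coe m≡m+0 ⨾ σ m 0                             ≋⟨ coeˡ m≡m+0 ⟩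
    σ m 0                                         ∎)
    where
    m≡m+0 = sym (+-identityʳ m)
    idempotent : σ {S} {k} m 0 ≋ σ {S} {k} m 0 ⨾ coe m≡m+0 ⨾ σ m 0
    idempotent =
      σ m 0
        ≈⟨ σ-hexagon m 0 0 ⟩
      coe (sym (+-assoc m 0 0)) ⨾ (σ m 0 ⊗ id 0) ⨾ coe (+-assoc 0 m 0)
        ⨾ (id 0 ⊗ σ m 0) ⨾ coe (sym (+-assoc 0 0 m))
        ≋⟨ coeˡ (sym (+-assoc m 0 0)) ⟩
      (σ m 0 ⊗ id 0) ⨾ coe (+-assoc 0 m 0) ⨾ (id 0 ⊗ σ m 0) ⨾ coe (sym (+-assoc 0 0 m))
        ≋⟨ ⨾-cong≋ unitʳ≋ (≋-trans (conjugate (+-assoc 0 m 0) (sym (+-assoc 0 0 m)))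
                            (≋-trans (≈⇒≋ ⊗-unitˡ) (≋-sym (coeˡ m≡m+0)))) ⟩
      σ m 0 ⨾ coe m≡m+0 ⨾ σ m 0 ∎

  σ-unitˡ : ∀ {k} m → σ {S} {k} 0 m ≋ id {S} {k} m
  σ-unitˡ m =
    σ 0 m                            ≋⟨ ≋-sym (coeʳ (+-identityʳ m)) ⟩
    σ 0 m ⨾ coe (+-identityʳ m)      ≋⟨ ⨾-cong≋ ≋-refl (≋-trans (coe-id (+-identityʳ m))
                                                                (≋-sym (σ-unitʳ m))) ⟩
    σ 0 m ⨾ σ m 0                    ≈⟨ σ-inverse 0 m ⟩
    id m                             ∎

  inner-assoc : ∀ a b c d → (a + b) + (c + d) ≡ a + ((b + c) + d)
  inner-assoc a b c d = trans (+-assoc a b (c + d)) (cong (a +_) (sym (+-assoc b c d)))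

  inner-assoc≋ : ∀ {k a b c d a′ b′ c′ d′}
                 {f : Circ S k a a′} {g : Circ S k b b′} {h : Circ S k c c′} {i : Circ S k d d′} →
                 (f ⊗ g) ⊗ (h ⊗ i) ≋ f ⊗ ((g ⊗ h) ⊗ i)
  inner-assoc≋ = ≋-trans assoc≋ (⊗-cong≋ ≋-refl (≋-sym assoc≋))

  -- The middle-four interchange. It is the tool for regrouping a tensor of pairs into a pair of
  -- tensors.
  interchange : ∀ {k} a b c d → Circ S k ((a + b) + (c + d)) ((a + c) + (b + d))
  interchange a b c d =
    coe (inner-assoc a b c d) ⨾ (id a ⊗ (σ b c ⊗ id d)) ⨾ coe (sym (inner-assoc a c b d))

  interchange≋ : ∀ {k} a b c d → interchange {k} a b c d ≋ id {S} {k} a ⊗ (σ b c ⊗ id d)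
  interchange≋ a b c d = conjugate (inner-assoc a b c d) (sym (inner-assoc a c b d))

  ι-interchange : ∀ a b c d → ι (interchange a b c d) ≈ interchange a b c d
  ι-interchange a b c d =
    ⨾-cong (ι-coe (inner-assoc a b c d)) (⨾-cong ≈-refl (ι-coe (sym (inner-assoc a c b d))))

  interchange-natural :
    ∀ {k a b c d a′ b′ c′ d′}
    {f : Circ S k a a′} {g : Circ S k b b′} {h : Circ S k c c′} {i : Circ S k d d′} →
    ((f ⊗ g) ⊗ (h ⊗ i)) ⨾ interchange a′ b′ c′ d′
      ≈ interchange a b c d ⨾ ((f ⊗ h) ⊗ (g ⊗ i))
  interchange-natural {a = a} {b} {c} {d} {a′} {b′} {c′} {d′} {f} {g} {h} {i} = ≋⇒≈ (
    ((f ⊗ g) ⊗ (h ⊗ i)) ⨾ interchange a′ b′ c′ d′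
      ≋⟨ ⨾-cong≋ inner-assoc≋ (interchange≋ a′ b′ c′ d′) ⟩
    (f ⊗ ((g ⊗ h) ⊗ i)) ⨾ (id a′ ⊗ (σ b′ c′ ⊗ id d′))
      ≈⟨ ≈-sym ⊗-⨾ ⟩
    (f ⨾ id a′) ⊗ (((g ⊗ h) ⊗ i) ⨾ (σ b′ c′ ⊗ id d′))
      ≈⟨ ⊗-cong ⨾-id-comm (≈-trans (≈-sym ⊗-⨾) (≈-trans (⊗-cong σ-natural ⨾-id-comm) ⊗-⨾)) ⟩
    (id a ⨾ f) ⊗ ((σ b c ⊗ id d) ⨾ ((h ⊗ g) ⊗ i))
      ≈⟨ ⊗-⨾ ⟩
    (id a ⊗ (σ b c ⊗ id d)) ⨾ (f ⊗ ((h ⊗ g) ⊗ i))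
      ≋⟨ ≋-sym (⨾-cong≋ (interchange≋ a b c d) inner-assoc≋) ⟩
    interchange a b c d ⨾ ((f ⊗ h) ⊗ (g ⊗ i)) ∎)
    where
    ⨾-id-comm : ∀ {k m n} {f : Circ S k m n} → f ⨾ id n ≈ id m ⨾ f
    ⨾-id-comm = ≈-trans ⨾-idʳ (≈-sym ⨾-idˡ)

  interchange-inverse : ∀ {k} a b c d →
    interchange {k} a b c d ⨾ interchange a c b d ≈ id ((a + b) + (c + d))
  interchange-inverse a b c d = ≋⇒≈ (
    interchange a b c d ⨾ interchange a c b d
      ≋⟨ ⨾-cong≋ (interchange≋ a b c d) (interchange≋ a c b d) ⟩
    (id a ⊗ (σ b c ⊗ id d)) ⨾ (id a ⊗ (σ c b ⊗ id d))
      ≈⟨ ≈-sym ⨾-id⊗ ⟩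
    id a ⊗ ((σ b c ⊗ id d) ⨾ (σ c b ⊗ id d))
      ≈⟨ ⊗-cong ≈-refl (≈-trans (≈-sym ⨾-⊗id) (⊗-cong (σ-inverse b c) ≈-refl)) ⟩
    id a ⊗ (id (b + c) ⊗ id d)
      ≈⟨ ⊗-cong ≈-refl (⊗-cong (≈-sym (⊗-id b c)) ≈-refl) ⟩
    id a ⊗ ((id b ⊗ id c) ⊗ id d)
      ≋⟨ ≋-sym inner-assoc≋ ⟩
    (id a ⊗ id b) ⊗ (id c ⊗ id d)
      ≈⟨ ⊗-cong (⊗-id a b) (⊗-id c d) ⟩
    id (a + b) ⊗ id (c + d)
      ≈⟨ ⊗-id (a + b) (c + d) ⟩
    id ((a + b) + (c + d)) ∎)

  middle-swap :
    ∀ {k a b c d a′ b′ c′ d′}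
    {f : Circ S k a a′} {g : Circ S k b b′} {h : Circ S k c c′} {i : Circ S k d d′} →
    (f ⊗ g) ⊗ (h ⊗ i)
      ≈ interchange a b c d ⨾ ((f ⊗ h) ⊗ (g ⊗ i)) ⨾ interchange a′ c′ b′ d′
  middle-swap {a′ = a′} {b′} {c′} {d′} =
    ≈-trans (≈-sym ⨾-idʳ)
    (≈-trans (⨾-cong ≈-refl (≈-sym (interchange-inverse a′ b′ c′ d′)))
    (≈-trans (≈-sym ⨾-assoc)
    (≈-trans (⨾-cong interchange-natural ≈-refl) ⨾-assoc)))

  -- Values, delays and registers

  values-++ : ∀ {m n} (us : Vec (Value S) m) (vs : Vec (Value S) n) →
              values {S} (us ++ vs) ≈ values us ⊗ values vs
  values-++ []       vs = ≈-sym ⊗-unitˡ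
  values-++ (u ∷ us) vs = ≈-trans (⊗-cong ≈-refl (values-++ us vs)) (≋⇒≈ (≋-sym assoc≋))

  δs-+ : ∀ m n → δs (m + n) ≈ δs {S} m ⊗ δs n
  δs-+ zero    n = ≈-sym ⊗-unitˡ
  δs-+ (suc m) n = ≈-trans (⊗-cong ≈-refl (δs-+ m n)) (≋⇒≈ (≋-sym assoc≋))

  -- Exposes the permutation hidden in the wirewise join as an `interchange`, so that its naturality
  -- can be used for registers.
  joins-suc : ∀ {k} n → joins {S} {k} (suc n) ≈ interchange 1 n 1 n ⨾ (join ⊗ joins n)
  joins-suc n = ≋⇒≈ (
    joins (suc n)
      ≋⟨ ⨾-cong≋ (≋-trans (⊗-cong≋ ≋-refl (coe-id (sym (+-assoc n 1 n))))
                          (≈⇒≋ (⊗-id 1 ((n + 1) + n)))) ≋-refl ⟩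
    id (1 + ((n + 1) + n)) ⨾ (id 1 ⊗ (σ n 1 ⊗ id n)) ⨾ (join ⊗ joins n)
      ≈⟨ ⨾-idˡ ⟩
    (id 1 ⊗ (σ n 1 ⊗ id n)) ⨾ (join ⊗ joins n)
      ≋⟨ ⨾-cong≋ (≋-sym (interchange≋ 1 n 1 n)) ≋-refl ⟩
    interchange 1 n 1 n ⨾ (join ⊗ joins n) ∎)

  reg₁ : Value S → SCirc S 1 1
  reg₁ v = (value v ⊗ δ) ⨾ join

  reg-∷ : ∀ {n} v (vs : Vec (Value S) n) → reg {S} (v ∷ vs) ≈ reg₁ v ⊗ reg vs
  reg-∷ {n} v vs = ≋⇒≈ (
    ((value v ⊗ values vs) ⊗ (δ ⊗ δs n)) ⨾ joins (suc n)
      ≈⟨ ⨾-cong ≈-refl (joins-suc n) ⟩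
    ((value v ⊗ values vs) ⊗ (δ ⊗ δs n)) ⨾ interchange 1 n 1 n ⨾ (join ⊗ joins n)
      ≈⟨ ≈-sym ⨾-assoc ⟩
    (((value v ⊗ values vs) ⊗ (δ ⊗ δs n)) ⨾ interchange 1 n 1 n) ⨾ (join ⊗ joins n)
      ≈⟨ ⨾-cong interchange-natural ≈-refl ⟩
    (interchange 0 0 1 n ⨾ ((value v ⊗ δ) ⊗ (values vs ⊗ δs n))) ⨾ (join ⊗ joins n)
      ≈⟨ ⨾-cong (⨾-cong trivial ≈-refl) ≈-refl ⟩
    (id (suc n) ⨾ ((value v ⊗ δ) ⊗ (values vs ⊗ δs n))) ⨾ (join ⊗ joins n)
      ≈⟨ ⨾-cong ⨾-idˡ ≈-refl ⟩
    ((value v ⊗ δ) ⊗ (values vs ⊗ δs n)) ⨾ (join ⊗ joins n)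
      ≈⟨ ≈-sym ⊗-⨾ ⟩
    reg₁ v ⊗ reg vs ∎)
    where
    -- Values have no inputs, so on the input side the permutation only moves an empty block past a
    -- wire.
    trivial : interchange 0 0 1 n ≈ id {S} {seq} (suc n)
    trivial = ≋⇒≈ (≋-trans (interchange≋ 0 0 1 n) (≋-trans (≈⇒≋ ⊗-unitˡ)
                (≋-trans (⊗-cong≋ (σ-unitˡ 1) ≋-refl) (≈⇒≋ (⊗-id 1 n)))))

  reg-++ : ∀ {m n} (us : Vec (Value S) m) (vs : Vec (Value S) n) →
           reg {S} (us ++ vs) ≈ reg us ⊗ reg vs
  reg-++ [] vs =
    ≈-sym (≈-trans (⊗-cong (≈-trans ⨾-idʳ (⊗-id 0 0)) ≈-refl) ⊗-unitˡ)
  reg-++ (u ∷ us) vs = ≋⇒≈ (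
    reg (u ∷ us ++ vs)             ≈⟨ reg-∷ u (us ++ vs) ⟩
    reg₁ u ⊗ reg (us ++ vs)        ≈⟨ ⊗-cong ≈-refl (reg-++ us vs) ⟩
    reg₁ u ⊗ (reg us ⊗ reg vs)     ≋⟨ ≋-sym assoc≋ ⟩
    (reg₁ u ⊗ reg us) ⊗ reg vs     ≈⟨ ⊗-cong (≈-sym (reg-∷ u us)) ≈-refl ⟩
    reg (u ∷ us) ⊗ reg vs          ∎)

  -- Traces

  Tr-pre : ∀ {x l m n} {f : SCirc S l m} {g : SCirc S (x + m) (x + n)} →
           f ⨾ Tr x g ≈ Tr x ((id x ⊗ f) ⨾ g)
  Tr-pre {x} {l} {m} {n} {f} {g} = ≋⇒≈ (
    f ⨾ Tr x g                          ≈⟨ ⨾-cong ≈-refl (≈-sym ⨾-idʳ) ⟩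
    f ⨾ Tr x g ⨾ id n                   ≈⟨ ≈-sym tightening ⟩
    Tr x ((id x ⊗ f) ⨾ g ⨾ (id x ⊗ id n)) ≈⟨ Tr-cong (⨾-cong ≈-refl
                                               (≈-trans (⨾-cong ≈-refl (⊗-id x n)) ⨾-idʳ)) ⟩
    Tr x ((id x ⊗ f) ⨾ g)               ∎)

  Tr-post : ∀ {x m n p} {f : SCirc S (x + m) (x + n)} {g : SCirc S n p} →
            Tr x f ⨾ g ≈ Tr x (f ⨾ (id x ⊗ g))
  Tr-post {x} {m} {n} {p} {f} {g} = ≋⇒≈ (
    Tr x f ⨾ g                          ≈⟨ ≈-sym ⨾-idˡ ⟩
    id m ⨾ Tr x f ⨾ g                   ≈⟨ ≈-sym tightening ⟩
    Tr x ((id x ⊗ id m) ⨾ f ⨾ (id x ⊗ g)) ≈⟨ Tr-cong (≈-trans (⨾-cong (⊗-id x m) ≈-refl) ⨾-idˡ) ⟩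
    Tr x (f ⨾ (id x ⊗ g))               ∎)

  -- Vanishing, with the rebracketing of the body left to the premise, so that callers supply the
  -- form they need.
  Tr-Tr : ∀ {x y m n} {f : SCirc S (x + (y + m)) (x + (y + n))}
          {g : SCirc S ((x + y) + m) ((x + y) + n)} →
          f ≋ g → Tr y {m} {n} (Tr x f) ≈ Tr (x + y) g
  Tr-Tr {x} {y} {m} {n} e =
    ≈-sym (≈-trans vanishing-+ (Tr-cong (Tr-cong (≋⇒≈
      (≋-trans (conjugate (sym (+-assoc x y m)) (+-assoc x y n)) (≋-sym e))))))

  Tr-⊗id : ∀ {x m n p} {f : SCirc S (x + m) (x + n)}
           {g : SCirc S (x + (m + p)) (x + (n + p))} →
           f ⊗ id p ≋ g → Tr x {m} {n} f ⊗ id p ≈ Tr x g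
  Tr-⊗id {x} {m} {n} {p} e =
    ≈-trans superposing (Tr-cong (≋⇒≈
      (≋-trans (conjugate (sym (+-assoc x m p)) (+-assoc x n p)) e)))

  -- Global trace-delay form

  stage : ∀ x y {z} → Vec (Value S) z → SCirc S ((x + y) + 0) ((x + y) + z)
  stage x y vs = (id x ⊗ δs y) ⊗ values vs

  -- A tensor of two stages is a stage only up to permutation, hence the circuits around it. They
  -- may be arbitrary combinational circuits because the core of the loop absorbs both in the end:
  -- `post` directly, `pre` after sliding.
  record Box {a b} (B : SCirc S a b) : Set where
    constructor box
    field
      {x y z} : ℕ
      vs      : Vec (Value S) z
      pre     : CCirc S a ((x + y) + 0)
      post    : CCirc S ((x + y) + z) b
      factors : B ≈ ι pre ⨾ stage x y vs ⨾ ι post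

  Box-id : ∀ n → Box (id n)
  Box-id n = box {x = n} {0} [] (coe p) (coe q) (≋⇒≈ (≋-sym (
    ι (coe p) ⨾ stage n 0 [] ⨾ ι (coe q)   ≈⟨ ⨾-cong (ι-coe p) (⨾-cong ≈-refl (ι-coe q)) ⟩
    coe p ⨾ stage n 0 [] ⨾ coe q           ≋⟨ conjugate p q ⟩
    (id n ⊗ id 0) ⊗ id 0                   ≋⟨ ≋-trans unitʳ≋ unitʳ≋ ⟩
    id n                                   ∎)))
    where
    q : (n + 0) + 0 ≡ n
    q = trans (+-identityʳ (n + 0)) (+-identityʳ n)
    p = sym q

  Box-δ : Box δ
  Box-δ = box {x = 0} {1} [] (id 1) (id 1) (≋⇒≈ (≋-sym (
    id 1 ⨾ stage 0 1 [] ⨾ id 1             ≈⟨ ≈-trans ⨾-idˡ ⨾-idʳ ⟩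
    (id 0 ⊗ (δ ⊗ id 0)) ⊗ id 0             ≋⟨ ≋-trans unitʳ≋ (≋-trans (≈⇒≋ ⊗-unitˡ) unitʳ≋) ⟩
    δ                                      ∎)))

  Box-value : ∀ v → Box (value {S} v)
  Box-value v = box {x = 0} {0} (v ∷ []) (id 0) (id 1) (≋⇒≈ (≋-sym (
    id 0 ⨾ stage 0 0 (v ∷ []) ⨾ id 1             ≈⟨ ≈-trans ⨾-idˡ ⨾-idʳ ⟩
    (id 0 ⊗ id 0) ⊗ (value v ⊗ id 0)       ≋⟨ ≋-trans (≈⇒≋ (≈-trans (⊗-cong ⊗-unitˡ ≈-refl) ⊗-unitˡ))
                                                      unitʳ≋ ⟩
    value v                                      ∎)))

  factor-through :
    ∀ {a b c d e f} {p : SCirc S a b} {p′ : SCirc S b c} {g : SCirc S c d}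
    {q′ : SCirc S d e} {q : SCirc S e f} →
    p ⨾ (p′ ⨾ g ⨾ q′) ⨾ q ≈ (p ⨾ p′) ⨾ g ⨾ q′ ⨾ q
  factor-through =
    ≈-trans (⨾-cong ≈-refl (≈-trans ⨾-assoc (⨾-cong ≈-refl ⨾-assoc))) (≈-sym ⨾-assoc)

  -- The outer interchange brings the values of both boxes together; the inner one then separates
  -- plain wires from delays.
  Box-⊗ : ∀ {a b c d} {B : SCirc S a b} {C : SCirc S c d} → Box B → Box C → Box (B ⊗ C)
  Box-⊗ {B = B} {C} (box {x} {y} {z} vs p q e) (box {x′} {y′} {z′} ws r s f) =
    box (vs ++ ws)
        ((p ⊗ r) ⨾ interchange (x + y) 0 (x′ + y′) 0 ⨾ (interchange x y x′ y′ ⊗ id 0))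
        (((interchange x x′ y y′ ⊗ id (z + z′)) ⨾ interchange (x + y) (x′ + y′) z z′) ⨾ (q ⊗ s))
        (≋⇒≈ (
    B ⊗ C
      ≈⟨ ⊗-cong e f ⟩
    (ι p ⨾ stage x y vs ⨾ ι q) ⊗ (ι r ⨾ stage x′ y′ ws ⨾ ι s)
      ≈⟨ ≈-trans ⊗-⨾ (⨾-cong ≈-refl ⊗-⨾) ⟩
    (ι p ⊗ ι r) ⨾ (stage x y vs ⊗ stage x′ y′ ws) ⨾ (ι q ⊗ ι s)
      ≈⟨ ⨾-cong ≈-refl (⨾-cong stage-⊗ ≈-refl) ⟩
    (ι p ⊗ ι r)
      ⨾ ( (interchange (x + y) 0 (x′ + y′) 0 ⨾ (interchange x y x′ y′ ⊗ id 0))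
        ⨾ stage (x + x′) (y + y′) (vs ++ ws)
        ⨾ (interchange x x′ y y′ ⊗ id (z + z′)) ⨾ interchange (x + y) (x′ + y′) z z′ )
      ⨾ (ι q ⊗ ι s)
      ≈⟨ factor-through ⟩
    ((ι p ⊗ ι r) ⨾ interchange (x + y) 0 (x′ + y′) 0 ⨾ (interchange x y x′ y′ ⊗ id 0))
      ⨾ stage (x + x′) (y + y′) (vs ++ ws)
      ⨾ ((interchange x x′ y y′ ⊗ id (z + z′)) ⨾ interchange (x + y) (x′ + y′) z z′) ⨾ (ι q ⊗ ι s)
      ≈⟨ ≈-sym (⨾-cong
           (⨾-cong ≈-refl (⨾-cong (ι-interchange (x + y) 0 (x′ + y′) 0)
                                  (⊗-cong (ι-interchange x y x′ y′) ≈-refl)))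
           (⨾-cong ≈-refl (⨾-cong (⨾-cong (⊗-cong (ι-interchange x x′ y y′) ≈-refl)
                                          (ι-interchange (x + y) (x′ + y′) z z′)) ≈-refl))) ⟩
    ι ((p ⊗ r) ⨾ interchange (x + y) 0 (x′ + y′) 0 ⨾ (interchange x y x′ y′ ⊗ id 0))
      ⨾ stage (x + x′) (y + y′) (vs ++ ws)
      ⨾ ι (((interchange x x′ y y′ ⊗ id (z + z′)) ⨾ interchange (x + y) (x′ + y′) z z′) ⨾ (q ⊗ s)) ∎))
    where
    stage-⊗ : stage x y vs ⊗ stage x′ y′ ws
            ≈ (interchange (x + y) 0 (x′ + y′) 0 ⨾ (interchange x y x′ y′ ⊗ id 0))
            ⨾ stage (x + x′) (y + y′) (vs ++ ws)
            ⨾ (interchange x x′ y y′ ⊗ id (z + z′)) ⨾ interchange (x + y) (x′ + y′) z z′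
    stage-⊗ = ≋⇒≈ (
      stage x y vs ⊗ stage x′ y′ ws
        ≈⟨ middle-swap ⟩
      interchange (x + y) 0 (x′ + y′) 0
        ⨾ (((id x ⊗ δs y) ⊗ (id x′ ⊗ δs y′)) ⊗ (values vs ⊗ values ws))
        ⨾ interchange (x + y) (x′ + y′) z z′
        -- The values are padded with identities to a threefold composite, so that `⊗-⨾` can split
        -- both factors in parallel.
        ≈⟨ ⨾-cong ≈-refl (⨾-cong (⊗-cong middle-swap
             (≈-trans (≈-sym ⨾-idˡ) (⨾-cong ≈-refl (≈-sym ⨾-idʳ)))) ≈-refl) ⟩
      interchange (x + y) 0 (x′ + y′) 0
        ⨾ ((interchange x y x′ y′ ⨾ ((id x ⊗ id x′) ⊗ (δs y ⊗ δs y′)) ⨾ interchange x x′ y y′)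
             ⊗ (id 0 ⨾ (values vs ⊗ values ws) ⨾ id (z + z′)))
        ⨾ interchange (x + y) (x′ + y′) z z′
        ≈⟨ ⨾-cong ≈-refl (⨾-cong (≈-trans ⊗-⨾ (⨾-cong ≈-refl ⊗-⨾)) ≈-refl) ⟩
      interchange (x + y) 0 (x′ + y′) 0
        ⨾ ((interchange x y x′ y′ ⊗ id 0)
          ⨾ (((id x ⊗ id x′) ⊗ (δs y ⊗ δs y′)) ⊗ (values vs ⊗ values ws))
          ⨾ (interchange x x′ y y′ ⊗ id (z + z′)))
        ⨾ interchange (x + y) (x′ + y′) z z′
        ≈⟨ factor-through ⟩
      (interchange (x + y) 0 (x′ + y′) 0 ⨾ (interchange x y x′ y′ ⊗ id 0))
        ⨾ (((id x ⊗ id x′) ⊗ (δs y ⊗ δs y′)) ⊗ (values vs ⊗ values ws))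
        ⨾ (interchange x x′ y y′ ⊗ id (z + z′)) ⨾ interchange (x + y) (x′ + y′) z z′
        ≈⟨ ≈-sym (⨾-cong ≈-refl (⨾-cong (⊗-cong (⊗-cong (≈-sym (⊗-id x x′)) (δs-+ y y′))
                                                  (values-++ vs ws)) ≈-refl)) ⟩
      (interchange (x + y) 0 (x′ + y′) 0 ⨾ (interchange x y x′ y′ ⊗ id 0))
        ⨾ stage (x + x′) (y + y′) (vs ++ ws)
        ⨾ (interchange x x′ y y′ ⊗ id (z + z′)) ⨾ interchange (x + y) (x′ + y′) z z′ ∎)

  -- The box need not have equally many inputs and outputs: a value contributes a wire to the core
  -- that no feedback wire feeds.
  record TraceForm {m n} (f : SCirc S m n) : Set where
    constructor traceForm
    field
      {a b}   : ℕ
      {B}     : SCirc S a b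
      isBox   : Box B
      core    : CCirc S (b + m) (a + n)
      factors : f ≈ Tr a ((B ⊗ id m) ⨾ ι core)

  TraceForm-resp-≈ : ∀ {m n} {f g : SCirc S m n} → f ≈ g → TraceForm g → TraceForm f
  TraceForm-resp-≈ d (traceForm B h e) = traceForm B h (≈-trans d e)

  TraceForm-ι : ∀ {m n} (h : CCirc S m n) → TraceForm (ι h)
  TraceForm-ι {m} h = traceForm (Box-id 0) h (≈-sym
    (≈-trans vanishing-0 (≈-trans (⨾-cong (⊗-id 0 m) ≈-refl) ⨾-idˡ)))

  TraceForm-δ : TraceForm δ
  -- With the symmetry as core, the delay moves across it to the output, and yanking straightens the
  -- remaining loop.
  TraceForm-δ = traceForm Box-δ (σ 1 1) (≋⇒≈ (≋-sym (
    Tr 1 ((δ ⊗ id 1) ⨾ σ 1 1)     ≈⟨ Tr-cong σ-natural ⟩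
    Tr 1 (σ 1 1 ⨾ (id 1 ⊗ δ))     ≈⟨ ≈-sym Tr-post ⟩
    Tr 1 (σ 1 1) ⨾ δ              ≈⟨ ⨾-cong (yanking 1) ≈-refl ⟩
    id 1 ⨾ δ                      ≈⟨ ⨾-idˡ ⟩
    δ                             ∎)))

  TraceForm-value : ∀ v → TraceForm (value {S} v)
  TraceForm-value v = traceForm (Box-value v) (id 1) (≋⇒≈ (≋-sym (
    Tr 0 ((value v ⊗ id 0) ⨾ id 1)   ≈⟨ ≈-trans vanishing-0 ⨾-idʳ ⟩
    value v ⊗ id 0                   ≋⟨ unitʳ≋ ⟩
    value v                          ∎)))

  TraceForm-pre : ∀ {l m n} (p : CCirc S l m) {f : SCirc S m n} →
                  TraceForm f → TraceForm (ι p ⨾ f)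
  TraceForm-pre {l} {m} p {f} (traceForm {a} {b} {B} isBox h e) =
    traceForm isBox ((id b ⊗ p) ⨾ h) (≋⇒≈ (
      ι p ⨾ f                                     ≈⟨ ⨾-cong ≈-refl e ⟩
      ι p ⨾ Tr a ((B ⊗ id m) ⨾ ι h)               ≈⟨ Tr-pre ⟩
      Tr a ((id a ⊗ ι p) ⨾ (B ⊗ id m) ⨾ ι h)      ≈⟨ Tr-cong (≈-sym ⨾-assoc) ⟩
      Tr a (((id a ⊗ ι p) ⨾ (B ⊗ id m)) ⨾ ι h)    ≈⟨ Tr-cong (⨾-cong (≈-trans (≈-sym slice′) slice) ≈-refl) ⟩
      Tr a (((B ⊗ id l) ⨾ (id b ⊗ ι p)) ⨾ ι h)    ≈⟨ Tr-cong ⨾-assoc ⟩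
      Tr a ((B ⊗ id l) ⨾ (id b ⊗ ι p) ⨾ ι h)      ∎))

  TraceForm-post : ∀ {l m n} {f : SCirc S l m} (q : CCirc S m n) →
                   TraceForm f → TraceForm (f ⨾ ι q)
  TraceForm-post {l} {m} {f = f} q (traceForm {a} {b} {B} isBox h e) =
    traceForm isBox (h ⨾ (id a ⊗ q)) (≋⇒≈ (
      f ⨾ ι q                                     ≈⟨ ⨾-cong e ≈-refl ⟩
      Tr a ((B ⊗ id l) ⨾ ι h) ⨾ ι q               ≈⟨ Tr-post ⟩
      Tr a (((B ⊗ id l) ⨾ ι h) ⨾ (id a ⊗ ι q))    ≈⟨ Tr-cong ⨾-assoc ⟩
      Tr a ((B ⊗ id l) ⨾ ι h ⨾ (id a ⊗ ι q))      ∎))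

  TraceForm-⊗id : ∀ {m n} p {f : SCirc S m n} → TraceForm f → TraceForm (f ⊗ id p)
  TraceForm-⊗id {m} {n} p {f} (traceForm {a} {b} {B} isBox h e) =
    traceForm isBox (coe r ⨾ (h ⊗ id p) ⨾ coe s) (≈-trans (⊗-cong e ≈-refl) (Tr-⊗id (
      ((B ⊗ id m) ⨾ ι h) ⊗ id p                   ≈⟨ ⨾-⊗id ⟩
      ((B ⊗ id m) ⊗ id p) ⨾ (ι h ⊗ id p)          ≋⟨ ⨾-cong≋ assoc≋ (≋-sym (ι-conjugate r s)) ⟩
      (B ⊗ (id m ⊗ id p)) ⨾ ι (coe r ⨾ (h ⊗ id p) ⨾ coe s)
                                                  ≈⟨ ⨾-cong (⊗-cong ≈-refl (⊗-id m p)) ≈-refl ⟩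
      (B ⊗ id (m + p)) ⨾ ι (coe r ⨾ (h ⊗ id p) ⨾ coe s) ∎)))
    where
    r = sym (+-assoc b m p)
    s = +-assoc a n p

  -- Superposing extends a trace on one side only; symmetries carry the identity over from the
  -- other.
  TraceForm-id⊗ : ∀ {m n} p {f : SCirc S m n} → TraceForm f → TraceForm (id p ⊗ f)
  TraceForm-id⊗ {m} {n} p F =
    TraceForm-resp-≈ σ-swap (TraceForm-pre (σ p m) (TraceForm-post (σ n p) (TraceForm-⊗id p F)))

  -- The common core of composition and feedback. The boxes of the inner and the outer loop act on
  -- disjoint wires, so vanishing merges the loops into one whose box is their tensor.
  TraceForm-Tr-box : ∀ {a b m n} {B : SCirc S a b} {f : SCirc S (b + m) (a + n)} →
                     Box B → TraceForm f → TraceForm (Tr a ((B ⊗ id m) ⨾ f))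
  TraceForm-Tr-box {a} {b} {m} {n} {B} {f} isBox (traceForm {a′} {b′} {B′} isBox′ h e) =
    traceForm (Box-⊗ isBox′ isBox) (coe r ⨾ h ⨾ coe s) (≋⇒≈ (
      Tr a ((B ⊗ id m) ⨾ f)
        ≈⟨ Tr-cong (⨾-cong ≈-refl e) ⟩
      Tr a ((B ⊗ id m) ⨾ Tr a′ ((B′ ⊗ id (b + m)) ⨾ ι h))
        ≈⟨ Tr-cong (≈-trans Tr-pre (Tr-cong (≈-sym ⨾-assoc))) ⟩
      Tr a (Tr a′ (((id a′ ⊗ (B ⊗ id m)) ⨾ (B′ ⊗ id (b + m))) ⨾ ι h))
        ≈⟨ Tr-cong (Tr-cong (⨾-cong (≈-sym slice′) ≈-refl)) ⟩
      Tr a (Tr a′ ((B′ ⊗ (B ⊗ id m)) ⨾ ι h))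
        ≈⟨ Tr-Tr (⨾-cong≋ (≋-sym assoc≋) (≋-sym (ι-conjugate r s))) ⟩
      Tr (a′ + a) (((B′ ⊗ B) ⊗ id m) ⨾ ι (coe r ⨾ h ⨾ coe s)) ∎))
    where
    r = +-assoc b′ b m
    s = sym (+-assoc a′ a n)

  -- A bare feedback loop is a loop through a box of plain wires.
  TraceForm-Tr : ∀ x {m n} {f : SCirc S (x + m) (x + n)} → TraceForm f → TraceForm (Tr x f)
  TraceForm-Tr x {m} F =
    TraceForm-resp-≈ (Tr-cong (≈-sym (≈-trans (⨾-cong (⊗-id x m) ≈-refl) ⨾-idˡ)))
                     (TraceForm-Tr-box (Box-id x) F)

  -- Tightening draws `f` into the loop of `g`, where it commutes with the box; what remains is a
  -- loop around a circuit already in trace form.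
  TraceForm-⨾ : ∀ {l m n} {f : SCirc S l m} {g : SCirc S m n} →
                TraceForm f → TraceForm g → TraceForm (f ⨾ g)
  TraceForm-⨾ {l} {m} {n} {f} {g} F (traceForm {a} {b} {B} isBox h e) =
    TraceForm-resp-≈ (≋⇒≈ (
      f ⨾ g                                     ≈⟨ ⨾-cong ≈-refl e ⟩
      f ⨾ Tr a ((B ⊗ id m) ⨾ ι h)               ≈⟨ Tr-pre ⟩
      Tr a ((id a ⊗ f) ⨾ (B ⊗ id m) ⨾ ι h)      ≈⟨ Tr-cong (≈-sym ⨾-assoc) ⟩
      Tr a (((id a ⊗ f) ⨾ (B ⊗ id m)) ⨾ ι h)    ≈⟨ Tr-cong (⨾-cong (≈-trans (≈-sym slice′) slice) ≈-refl) ⟩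
      Tr a (((B ⊗ id l) ⨾ (id b ⊗ f)) ⨾ ι h)    ≈⟨ Tr-cong ⨾-assoc ⟩
      Tr a ((B ⊗ id l) ⨾ (id b ⊗ f) ⨾ ι h)      ∎))
    (TraceForm-Tr-box isBox (TraceForm-post h (TraceForm-id⊗ b F)))

  value-≢• : ∀ v .(ne : v ≢ Signature.• S) → value {S} v ≡ val v ne
  value-≢• v ne with Signature._≟_ S v (Signature.• S)
  ... | yes v≡• = ⊥-elim-irr (ne v≡•)
  -- The proof in `val` is irrelevant, so the one found by the decision agrees with `ne`.
  ... | no  _   = refl

  all-TraceForm : ∀ {m n} (f : SCirc S m n) → TraceForm f
  all-TraceForm (id n)  = TraceForm-ι (id n)
  all-TraceForm (f ⨾ g) = TraceForm-⨾ (all-TraceForm f) (all-TraceForm g)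
  all-TraceForm (_⊗_ {n = n} {p} f g) =
    TraceForm-resp-≈ slice
      (TraceForm-⨾ (TraceForm-⊗id p (all-TraceForm f)) (TraceForm-id⊗ n (all-TraceForm g)))
  all-TraceForm (σ m n)    = TraceForm-ι (σ m n)
  all-TraceForm (prim p)   = TraceForm-ι (prim p)
  all-TraceForm fork       = TraceForm-ι fork
  all-TraceForm join       = TraceForm-ι join
  all-TraceForm intro      = TraceForm-ι intro
  all-TraceForm elim       = TraceForm-ι elim
  all-TraceForm (val v ne) = subst TraceForm (value-≢• v ne) (TraceForm-value v)
  all-TraceForm δ          = TraceForm-δ
  all-TraceForm (Tr x f)   = TraceForm-Tr x (all-TraceForm f)

  record GlobalTraceDelay {m n} (f : SCirc S m n) : Set where
    constructor globalTraceDelay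
    field
      x y {z} : ℕ
      vs      : Vec (Value S) z
      core    : CCirc S ((x + y) + (z + m)) ((x + y) + n)
      factors : f ≈ Tr (x + y) (((id x ⊗ δs y) ⊗ (values vs ⊗ id m)) ⨾ ι core)

  -- Sliding the rearrangement of the feedback wires around the loop sorts them.
  toGlobalTraceDelay : ∀ {m n} {f : SCirc S m n} → TraceForm f → GlobalTraceDelay f
  toGlobalTraceDelay {m} {n} {f} (traceForm {a} {b} {B} (box {x} {y} {z} vs p q d) h e) =
    globalTraceDelay x y vs (coe r ⨾ sorted ⨾ coe s) (≋⇒≈ (
      f
        ≈⟨ e ⟩
      Tr a ((B ⊗ id m) ⨾ ι h)
        ≈⟨ Tr-cong (⨾-cong (≈-trans (⊗-cong d ≈-refl)
             (≈-trans ⨾-⊗id (⨾-cong ≈-refl ⨾-⊗id))) ≈-refl) ⟩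
      Tr a (((ι p ⊗ id m) ⨾ (stage x y vs ⊗ id m) ⨾ (ι q ⊗ id m)) ⨾ ι h)
        ≈⟨ Tr-cong (≈-trans ⨾-assoc (⨾-cong ≈-refl ⨾-assoc)) ⟩
      Tr a ((ι p ⊗ id m) ⨾ (stage x y vs ⊗ id m) ⨾ (ι q ⊗ id m) ⨾ ι h)
        ≈⟨ ≈-sym sliding ⟩
      Tr ((x + y) + 0) (((stage x y vs ⊗ id m) ⨾ (ι q ⊗ id m) ⨾ ι h) ⨾ (ι p ⊗ id n))
        ≈⟨ Tr-cong (≈-trans ⨾-assoc (⨾-cong ≈-refl ⨾-assoc)) ⟩
      Tr ((x + y) + 0) ((stage x y vs ⊗ id m) ⨾ ι sorted)
        ≋⟨ Tr-cong≋ (+-identityʳ (x + y)) (⨾-cong≋ assoc≋ (≋-sym (ι-conjugate r s))) ⟩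
      Tr (x + y) (((id x ⊗ δs y) ⊗ (values vs ⊗ id m)) ⨾ ι (coe r ⨾ sorted ⨾ coe s)) ∎))
    where
    sorted : CCirc S (((x + y) + z) + m) (((x + y) + 0) + n)
    sorted = (q ⊗ id m) ⨾ h ⨾ (p ⊗ id n)
    r = sym (+-assoc (x + y) z m)
    s = cong (_+ n) (+-identityʳ (x + y))

  -- The number of generators to which a value rule could apply is an invariant of
  -- the free symmetric traced category.
  consumers : ∀ {k m n} → Circ S k m n → ℕ
  consumers (id n)    = 0
  consumers (f ⨾ g)   = consumers f + consumers g
  consumers (f ⊗ g)   = consumers f + consumers g
  consumers (σ m n)   = 0
  consumers (prim p)  = 1
  consumers fork      = 1
  consumers join      = 1
  consumers intro     = 0
  consumers elim      = 1
  consumers (val v _) = 0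
  consumers δ         = 0
  consumers (Tr x f)  = consumers f

  consumers-coe : ∀ {k m n} (p : m ≡ n) → consumers (coe {k = k} p) ≡ 0
  consumers-coe refl = refl

  consumers-conjugate : ∀ {k l m n o} (p : l ≡ m) (f : Circ S k m n) (q : n ≡ o) →
                        consumers (coe p ⨾ f ⨾ coe q) ≡ consumers f
  consumers-conjugate refl f refl = +-identityʳ (consumers f)

  consumers-⨾-coe : ∀ {k l l′ m n} {f : Circ S k l m} (q : m ≡ n) (p : l ≡ l′) {g : Circ S k l′ n} →
                    consumers f ≡ consumers g → consumers (f ⨾ coe q) ≡ consumers (coe p ⨾ g)
  consumers-⨾-coe refl refl e = trans (+-identityʳ _) e

  -- Every axiom uses each of its circuits exactly once on either side and otherwise involves only
  -- identities, symmetries and traces, which contribute nothing.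
  consumers-resp-≈ : ∀ {k m n} {f g : Circ S k m n} → f ≈ g → consumers f ≡ consumers g
  consumers-resp-≈ ≈-refl         = refl
  consumers-resp-≈ (≈-sym e)      = sym (consumers-resp-≈ e)
  consumers-resp-≈ (≈-trans d e)  = trans (consumers-resp-≈ d) (consumers-resp-≈ e)
  consumers-resp-≈ (⨾-cong d e)   = cong₂ _+_ (consumers-resp-≈ d) (consumers-resp-≈ e)
  consumers-resp-≈ (⊗-cong d e)   = cong₂ _+_ (consumers-resp-≈ d) (consumers-resp-≈ e)
  consumers-resp-≈ (Tr-cong e)    = consumers-resp-≈ e
  consumers-resp-≈ ⨾-idˡ          = refl
  consumers-resp-≈ ⨾-idʳ          = +-identityʳ _
  consumers-resp-≈ (⨾-assoc {f = f} {g} {h}) =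
    +-assoc (consumers f) (consumers g) (consumers h)
  consumers-resp-≈ (⊗-id m n)     = refl
  consumers-resp-≈ (⊗-⨾ {f = f} {g} {h} {i}) =
    +-interchange (consumers f) (consumers g) (consumers h) (consumers i)
  consumers-resp-≈ ⊗-unitˡ        = refl
  consumers-resp-≈ (⊗-unitʳ {m = m} {n} {f}) =
    consumers-⨾-coe {f = f ⊗ id 0} (+-identityʳ n) (+-identityʳ m) {f} (+-identityʳ _)
  consumers-resp-≈ (⊗-assoc {m = m} {n} {p} {q} {r} {s} {f} {g} {h}) =
    consumers-⨾-coe {f = (f ⊗ g) ⊗ h} (+-assoc n q s) (+-assoc m p r) {f ⊗ (g ⊗ h)}
      (+-assoc (consumers f) (consumers g) (consumers h))
  consumers-resp-≈ (σ-natural {f = f} {g}) =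
    trans (+-identityʳ _) (+-comm (consumers f) (consumers g))
  consumers-resp-≈ (σ-inverse m n) = refl
  consumers-resp-≈ (σ-hexagon {k} m n p) = sym
    (cong₂ _+_ (consumers-coe {k} (sym (+-assoc m n p)))
      (cong₂ _+_ (consumers-coe {k} (+-assoc n m p)) (consumers-coe {k} (sym (+-assoc n p m)))))
  consumers-resp-≈ tightening     = refl
  consumers-resp-≈ (sliding {g = g} {h}) =
    +-comm (consumers g) (consumers h + 0)
  consumers-resp-≈ vanishing-0    = refl
  consumers-resp-≈ (vanishing-+ {x} {y} {m} {n} {f}) =
    sym (consumers-conjugate (sym (+-assoc x y m)) f (+-assoc x y n))
  consumers-resp-≈ (superposing {x} {m} {n} {p} {q} {f} {g}) =
    sym (consumers-conjugate (sym (+-assoc x m p)) (f ⊗ g) (+-assoc x n q))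
  consumers-resp-≈ (yanking x)    = refl

  consumers-[] : ∀ {a b m n} (C : Context a b m n) (f : SCirc S a b) →
                 consumers f ≤ consumers (C [ f ])
  consumers-[] □        f = ≤-refl
  consumers-[] (C ⨾ˡ g) f = ≤-trans (consumers-[] C f) (m≤m+n _ _)
  consumers-[] (g ⨾ʳ C) f = ≤-trans (consumers-[] C f) (m≤n+m _ _)
  consumers-[] (C ⊗ˡ g) f = ≤-trans (consumers-[] C f) (m≤m+n _ _)
  consumers-[] (g ⊗ʳ C) f = ≤-trans (consumers-[] C f) (m≤n+m _ _)
  consumers-[] (Tr x C) f = consumers-[] C f

  consumers-value : ∀ v → consumers (value {S} v) ≡ 0
  consumers-value v with Signature._≟_ S v (Signature.• S)
  ... | yes _ = refl
  ... | no  _ = refl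

  consumers-values : ∀ {n} (vs : Vec (Value S) n) → consumers (values {S} vs) ≡ 0
  consumers-values []       = refl
  consumers-values (v ∷ vs) = cong₂ _+_ (consumers-value v) (consumers-values vs)

  value-• : value {S} (Signature.• S) ≡ intro
  value-• with Signature._≟_ S (Signature.• S) (Signature.• S)
  ... | yes _ = refl
  ... | no ne = ⊥-elim (ne refl)

  -- Rewriting

  Rewrites : Rule {S} → Rule {S}
  Rewrites R s t = ∃[ u ] (Star (Step R) s u × u ≈ t)

  module _ {R : Rule {S}} where

    -- The equation is absorbed by the first step or, if there is none, by the final equivalence.
    Rewrites-respˡ : ∀ {m n} {s s′ t : SCirc S m n} → s ≈ s′ → Rewrites R s′ t → Rewrites R s t
    Rewrites-respˡ d (_ , ε , e) = _ , ε , ≈-trans d e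
    Rewrites-respˡ d (u , (_ , _ , C , l , r , e , ρ , e′) ◅ ss , e″) =
      u , (_ , _ , C , l , r , ≈-trans d e , ρ , e′) ◅ ss , e″

    Rewrites-respʳ : ∀ {m n} {s t t′ : SCirc S m n} → Rewrites R s t → t ≈ t′ → Rewrites R s t′
    Rewrites-respʳ (u , ss , e) e′ = u , ss , ≈-trans e e′

    Rewrites-trans : ∀ {m n} {s t u : SCirc S m n} → Rewrites R s t → Rewrites R t u → Rewrites R s u
    Rewrites-trans (_ , ss , e) ts with Rewrites-respˡ e ts
    ... | u , ss′ , e′ = u , ss ◅◅ ss′ , e′

    Rewrites-refl : ∀ {m n} {s t : SCirc S m n} → s ≈ t → Rewrites R s t
    Rewrites-refl e = _ , ε , e

    rewrite-redex : ∀ {m n} {s t : SCirc S m n} → R s t → Rewrites R s t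
    rewrite-redex ρ = _ , (_ , _ , □ , _ , _ , ≈-refl , ρ , ≈-refl) ◅ ε , ≈-refl

    Rewrites-⨾ˡ : ∀ {l m n} {s t : SCirc S l m} (g : SCirc S m n) →
                  Rewrites R s t → Rewrites R (s ⨾ g) (t ⨾ g)
    Rewrites-⨾ˡ g (_ , ss , e) =
      _ , gmap (_⨾ g) (λ (_ , _ , C , l , r , d , ρ , d′) →
            _ , _ , C ⨾ˡ g , l , r , ⨾-cong d ≈-refl , ρ , ⨾-cong d′ ≈-refl) ss
        , ⨾-cong e ≈-refl

    Rewrites-⊗ˡ : ∀ {m n p q} {s t : SCirc S m n} (g : SCirc S p q) →
                  Rewrites R s t → Rewrites R (s ⊗ g) (t ⊗ g)
    Rewrites-⊗ˡ g (_ , ss , e) =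
      _ , gmap (_⊗ g) (λ (_ , _ , C , l , r , d , ρ , d′) →
            _ , _ , C ⊗ˡ g , l , r , ⊗-cong d ≈-refl , ρ , ⊗-cong d′ ≈-refl) ss
        , ⊗-cong e ≈-refl

    Rewrites-⊗ʳ : ∀ {m n p q} {s t : SCirc S m n} (g : SCirc S p q) →
                  Rewrites R s t → Rewrites R (g ⊗ s) (g ⊗ t)
    Rewrites-⊗ʳ g (_ , ss , e) =
      _ , gmap (g ⊗_) (λ (_ , _ , C , l , r , d , ρ , d′) →
            _ , _ , g ⊗ʳ C , l , r , ⊗-cong ≈-refl d , ρ , ⊗-cong ≈-refl d′) ss
        , ⊗-cong ≈-refl e

  -- Registers before and behind a loop

  -- Prepares (IF): vanishing separates the undelayed wires `x` from the state wires `c`, and all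
  -- registers leave the inner trace by tightening, which frees its body of delays and values.
  pull-registers-in : ∀ x {c m n} (s : Vec (Value S) c) (v : Vec (Value S) m)
    {h : SCirc S ((x + c) + m) ((x + c) + n)} {h′ : SCirc S (x + (c + m)) (x + (c + n))} →
    h′ ≋ h →
    reg v ⨾ Tr (x + c) (((id x ⊗ reg s) ⊗ id m) ⨾ h) ≈ Tr c (reg (s ++ v) ⨾ Tr x h′)
  pull-registers-in x {c} {m} {n} s v {h} {h′} e = ≋⇒≈ (
    reg v ⨾ Tr (x + c) (((id x ⊗ reg s) ⊗ id m) ⨾ h)
      ≈⟨ Tr-pre ⟩
    Tr (x + c) ((id (x + c) ⊗ reg v) ⨾ ((id x ⊗ reg s) ⊗ id m) ⨾ h)
      ≈⟨ Tr-cong (≈-trans (≈-sym ⨾-assoc) (⨾-cong (≈-sym slice′) ≈-refl)) ⟩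
    Tr (x + c) (((id x ⊗ reg s) ⊗ reg v) ⨾ h)
      ≈⟨ ≈-sym (Tr-Tr (⨾-cong≋ (≋-sym assoc≋) e)) ⟩
    Tr c (Tr x ((id x ⊗ (reg s ⊗ reg v)) ⨾ h′))
      ≈⟨ Tr-cong (≈-sym Tr-pre) ⟩
    Tr c ((reg s ⊗ reg v) ⨾ Tr x h′)
      ≈⟨ Tr-cong (⨾-cong (≈-sym (reg-++ s v)) ≈-refl) ⟩
    Tr c (reg (s ++ v) ⨾ Tr x h′) ∎)

  -- The left side is what (Str) yields inside the feedback once its copy is evaluated. Since values
  -- have no inputs, `k` factors out in front, and the rest is a register again.
  push-registers-out : ∀ {c m n} (t : Vec (Value S) c) (w : Vec (Value S) n)
    (k : SCirc S (c + m) (c + n)) →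
    Tr c ((values (t ++ w) ⊗ (k ⨾ δs (c + n))) ⨾ joins (c + n))
      ≈ Tr c (k ⨾ (reg t ⊗ id n)) ⨾ reg w
  push-registers-out {c} {m} {n} t w k = ≋⇒≈ (
    Tr c ((values (t ++ w) ⊗ (k ⨾ δs (c + n))) ⨾ joins (c + n))
      ≈⟨ Tr-cong (⨾-cong (⊗-cong (≈-sym ⨾-idˡ) ≈-refl) ≈-refl) ⟩
    Tr c (((id 0 ⨾ values (t ++ w)) ⊗ (k ⨾ δs (c + n))) ⨾ joins (c + n))
      ≈⟨ Tr-cong (≈-trans (⨾-cong ⊗-⨾ ≈-refl) (≈-trans ⨾-assoc (⨾-cong ⊗-unitˡ ≈-refl))) ⟩
    Tr c (k ⨾ reg (t ++ w))
      ≈⟨ Tr-cong (⨾-cong ≈-refl (≈-trans (reg-++ t w) slice)) ⟩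
    Tr c (k ⨾ (reg t ⊗ id n) ⨾ (id c ⊗ reg w))
      ≈⟨ Tr-cong (≈-sym ⨾-assoc) ⟩
    Tr c ((k ⨾ (reg t ⊗ id n)) ⨾ (id c ⊗ reg w))
      ≈⟨ ≈-sym Tr-post ⟩
    Tr c (k ⨾ (reg t ⊗ id n)) ⨾ reg w ∎)

-- Existence of longest chains

greatest : ∀ {p} {P : ℕ → Set p} → (∀ n → Dec (P n)) → P 0 → ∀ N → (∀ {n} → P n → n ≤ N) →
           ∃[ n ] (P n × (∀ {m} → P m → m ≤ n))
greatest P? p₀ zero    bound = 0 , p₀ , bound
greatest {P = P} P? p₀ (suc N) bound with P? (suc N)
... | yes p = suc N , p , bound
... | no ¬p = greatest P? p₀ N λ q → s≤s⁻¹ (≤∧≢⇒< (bound q) λ eq → ¬p (subst P eq q))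

module _ {S : Signature} (I : Interpretation S) where
  open Interpretation I
  open Signature S using (card; finite; •; _≟_)
  open Inverse finite using (to; from; strictlyInverseʳ)
  open IsLattice isLattice using (antisym; x≤x∨y; y≤x∨y; ∨-least) renaming (refl to ⊑-refl)

  -- The order is decidable because the join determines it and equality of values is decidable.
  _⊑?_ : ∀ u v → Dec (u ⊑ v)
  u ⊑? v = map′ (λ eq → subst (u ⊑_) eq (x≤x∨y u v))
                (λ u⊑v → antisym (∨-least u⊑v ⊑-refl) (y≤x∨y u v))
                (u ⊔ v ≟ v)

  encode : ∀ {x} → Vec (Value S) x → Fin (card ^ x)
  encode vs = funToFin (to ∘ lookup vs)

  decode : ∀ {x} → Fin (card ^ x) → Vec (Value S) x
  decode i = tabulate (from ∘ finToFun i)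

  decode-encode : ∀ {x} (vs : Vec (Value S) x) → decode (encode vs) ≡ vs
  decode-encode vs = trans
    (tabulate-cong λ i → trans (cong from (finToFun-funToFin (to ∘ lookup vs) i))
                               (strictlyInverseʳ (lookup vs i)))
    (tabulate∘lookup vs)

  IsChain : ∀ {x ℓ} → (Fin (suc ℓ) → Vec (Value S) x) → Set
  IsChain c = ∀ i j → i <ᶠ j → c i ⊑* c j × c i ≢ c j

  isChain? : ∀ {x ℓ} (c : Fin (suc ℓ) → Vec (Value S) x) → Dec (IsChain c)
  isChain? c = all? λ i → all? λ j →
    (i <ᶠ? j) →-dec (decidable _⊑?_ (c i) (c j) ×-dec ¬? (≡-dec _≟_ (c i) (c j)))

  -- Candidate chains are maps between finite sets, so a search through their codes decides
  -- existence. It suffices that every map agrees pointwise with some decoded one.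
  chain? : ∀ x ℓ → Dec (Chain x ℓ)
  chain? x ℓ = map′ (λ (e , isChain) → decodeChain e , λ {i} {j} → isChain i j)
                    (λ (c , isChain) → funToFin (encode ∘ c) , λ i j i<j →
                      subst₂ (λ u v → u ⊑* v × u ≢ v)
                             (sym (decodeChain-funToFin c i)) (sym (decodeChain-funToFin c j))
                             (isChain i<j))
                    (any? λ e → isChain? (decodeChain e))
    where
    decodeChain : Fin ((card ^ x) ^ suc ℓ) → Fin (suc ℓ) → Vec (Value S) x
    decodeChain e i = decode (finToFun e i)
    decodeChain-funToFin : ∀ c i → decodeChain (funToFin (encode ∘ c)) i ≡ c i
    decodeChain-funToFin c i =
      trans (cong decode (finToFun-funToFin (encode ∘ c) i)) (decode-encode (c i))

  -- By trichotomy of the indices, the members of a chain are pairwise distinct.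
  chain-bound : ∀ {x ℓ} → Chain x ℓ → ℓ ≤ card ^ x
  chain-bound {x} {ℓ} (c , isChain) =
    ≤-trans (n≤1+n ℓ) (injective⇒≤ {f = encode ∘ c} injective)
    where
    injective : ∀ {i j} → encode (c i) ≡ encode (c j) → i ≡ j
    injective {i} {j} eq with <ᶠ-cmp i j | ci≡cj′
      where
      ci≡cj′ : c i ≡ c j
      ci≡cj′ =
        trans (sym (decode-encode (c i))) (trans (cong decode eq) (decode-encode (c j)))
    ... | tri< i<j _ _ | ci≡cj = ⊥-elim (proj₂ (isChain i<j) ci≡cj)
    ... | tri≈ _ i≡j _ | _     = i≡j
    ... | tri> _ _ j<i | ci≡cj = ⊥-elim (proj₂ (isChain j<i) (sym ci≡cj))

  longestChain : ∀ x → ∃[ c ] LongestChainLength x c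
  longestChain x =
    -- A single vector is a chain of length 0: one index admits no strict inequality.
    greatest (chain? x) ((λ _ → replicate x •) , λ { {zero} {zero} () }) (card ^ x) chain-bound

  -- Evaluation by the value rules

  eval : ∀ {a b} → CCirc S a b → Vec (Value S) a → Vec (Value S) b
  eval (id n)    vs           = vs
  eval (f ⨾ g)   vs           = eval g (eval f vs)
  eval (_⊗_ {m = m} f g) vs   = eval f (take m vs) ++ eval g (drop m vs)
  eval (σ m n)   vs           = drop m vs ++ take m vs
  eval (prim p)  vs           = ⟦ p ⟧ vs
  eval fork      (v ∷ [])     = v ∷ v ∷ []
  eval join      (v ∷ w ∷ []) = (v ⊔ w) ∷ []
  eval intro     []           = • ∷ []
  eval elim      (v ∷ [])     = []

  values-split : ∀ m {n} (vs : Vec (Value S) (m + n)) →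
                 values {S} vs ≈ values (take m vs) ⊗ values (drop m vs)
  values-split m vs =
    subst (λ us → values {S} us ≈ values (take m vs) ⊗ values (drop m vs))
          (take++drop≡id m vs) (values-++ (take m vs) (drop m vs))

  -- Rules fire only at primitives, forks, joins and eliminations. The structural cases follow from
  -- the axioms, and an introduction already is the value `•`.
  values-eval : ∀ {a b} (h : CCirc S a b) (vs : Vec (Value S) a) →
                Rewrites (ValueRule I) (values vs ⨾ ι h) (values (eval h vs))
  values-eval (id n)  vs = Rewrites-refl ⨾-idʳ
  values-eval (f ⨾ g) vs =
    Rewrites-respˡ (≈-sym ⨾-assoc)
      (Rewrites-trans (Rewrites-⨾ˡ (ι g) (values-eval f vs)) (values-eval g (eval f vs)))
  values-eval (_⊗_ {m = m} f g) vs =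
    Rewrites-respˡ (≈-trans (⨾-cong (values-split m vs) ≈-refl) (≈-sym ⊗-⨾))
      (Rewrites-trans (Rewrites-⊗ˡ _ (values-eval f (take m vs)))
        (Rewrites-respʳ (Rewrites-⊗ʳ _ (values-eval g (drop m vs)))
          (≈-sym (values-++ (eval f (take m vs)) (eval g (drop m vs))))))
  values-eval (σ m n) vs = Rewrites-refl (≋⇒≈ (
    values vs ⨾ σ m n                                      ≈⟨ ⨾-cong (values-split m vs) ≈-refl ⟩
    (values (take m vs) ⊗ values (drop m vs)) ⨾ σ m n      ≈⟨ σ-natural ⟩
    σ 0 0 ⨾ (values (drop m vs) ⊗ values (take m vs))      ≈⟨ ⨾-cong (≋⇒≈ (σ-unitˡ 0)) ≈-refl ⟩
    id 0 ⨾ (values (drop m vs) ⊗ values (take m vs))       ≈⟨ ⨾-idˡ ⟩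
    values (drop m vs) ⊗ values (take m vs)                ≈⟨ ≈-sym (values-++ (drop m vs) (take m vs)) ⟩
    values (drop m vs ++ take m vs)                        ∎))
  values-eval (prim p) vs = rewrite-redex (v-prim p vs)
  values-eval fork (v ∷ []) =
    Rewrites-respˡ (⨾-cong (≋⇒≈ unitʳ≋) ≈-refl)
      (Rewrites-respʳ (rewrite-redex (v-fork v)) (⊗-cong ≈-refl (≋⇒≈ (≋-sym unitʳ≋))))
  values-eval join (v ∷ w ∷ []) =
    Rewrites-respˡ (⨾-cong (⊗-cong ≈-refl (≋⇒≈ unitʳ≋)) ≈-refl)
      (Rewrites-respʳ (rewrite-redex (v-join v w)) (≋⇒≈ (≋-sym unitʳ≋)))
  values-eval intro [] = Rewrites-refl (≈-trans ⨾-idˡ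
    (subst (λ f → intro ≈ f ⊗ id 0) (sym value-•) (≋⇒≈ (≋-sym unitʳ≋))))
  values-eval elim (v ∷ []) =
    Rewrites-respˡ (⨾-cong (≋⇒≈ unitʳ≋) ≈-refl) (rewrite-redex (v-elim v))

  consumers-redex : ∀ {a b} {l r : SCirc S a b} → ValueRule I l r → 1 ≤ consumers l
  consumers-redex (v-fork v)    = m≤n+m 1 _
  consumers-redex (v-join v w)  = m≤n+m 1 _
  consumers-redex (v-elim v)    = m≤n+m 1 _
  consumers-redex (v-prim p vs) = m≤n+m 1 _

  -- Every redex contains a consumer, no context removes it, and `_≈_` preserves the count, which is
  -- zero for a tensor of values.
  values-normal : ∀ {n} (vs : Vec (Value S) n) {u} → ¬ Step (ValueRule I) (values vs) u
  values-normal vs (_ , _ , C , l , _ , e , ρ , _) =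
    n≮0 (subst (1 ≤_) (trans (sym (consumers-resp-≈ e)) (consumers-values vs))
               (≤-trans (consumers-redex ρ) (consumers-[] C l)))

corollary5p32 : (S : Signature) (I : Interpretation S) {m n : ℕ}
    (f : SCirc S m n) (v : Vec (Value S) m) →
    Σ (Vec (Value S) n) λ w → Σ (SCirc S m n) λ g →
    Procedure I (reg v ⨾ f) (g ⨾ reg w)
corollary5p32 S I {m} {n} f v
  with toGlobalTraceDelay (all-TraceForm f)
... | globalTraceDelay x y {z} vs f̂ f≈
  with longestChain I x
... | ℓ , longest =
  w , Tr c (ι k ⨾ (reg t ⊗ id n)) ,
  reg v ⨾ Tr (x + c) (((id x ⊗ reg s) ⊗ id m)
                       ⨾ coe p ⨾ ι f̂ ⨾ (id (x + y) ⊗ (intros z ⊗ id n)) ⨾ coe q) ,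
  Tr c (reg (s ++ v) ⨾ ι k) ,
  -- (Mealy) acts on `f` alone; the input register stays in the context.
  (_ , _ , reg v ⨾ʳ □ , _ , _ , ⨾-cong ≈-refl f≈ , mealy x y z f̂ vs , ≈-refl) ,
  (_ , _ , Tr c (reg (s ++ v) ⨾ʳ □) , _ , _ ,
     pull-registers-in x s v ι-h , if x h longest , ≈-refl) ,
  record
    { context    = Tr c □
    ; source     = ≈-refl
    ; rewriting  = str k (s ++ v)
    ; evaluation = values-eval I k (s ++ v) , values-normal I (eval I k (s ++ v))
    -- Evaluation gives one vector for all outputs of `k`; it is split here into its state part and
    -- its output part.
    ; target     = subst (λ u → Tr c ((values {S} u ⊗ (ι k ⨾ δs (c + n))) ⨾ joins (c + n))
                                  ≈ Tr c (ι k ⨾ (reg t ⊗ id n)) ⨾ reg w)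
                         (take++drop≡id c (eval I k (s ++ v)))
                         (push-registers-out t w (ι k))
    }
  where
  -- The state wires: `y` delays, whose registers start at `•`, and `z` values that (Mealy) turns
  -- into registers.
  c = y + z
  s = replicate y (Signature.• S) ++ vs
  p = shuffle {S} x y z m
  q = sym (shuffle {S} x y z n)
  -- (IF) requires a body in the image of `ι`, so the loop body produced by (Mealy) is rebuilt among
  -- combinational circuits; `h` rebrackets it to single out the feedback `x`.
  h₀ : CCirc S ((x + c) + m) ((x + c) + n)
  h₀ = coe p ⨾ f̂ ⨾ (id (x + y) ⊗ (intros z ⊗ id n)) ⨾ coe q
  h : CCirc S (x + (c + m)) (x + (c + n))
  h = coe (sym (+-assoc x c m)) ⨾ h₀ ⨾ coe (+-assoc x c n)
  ι-h : ι h ≋ coe p ⨾ ι f̂ ⨾ (id (x + y) ⊗ (intros z ⊗ id n)) ⨾ coe q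
  ι-h = ≋-trans (ι-conjugate (sym (+-assoc x c m)) (+-assoc x c n))
    (≈⇒≋ (⨾-cong (ι-coe p) (⨾-cong ≈-refl (⨾-cong
      (⊗-cong ≈-refl (⊗-cong (subst (_≈ intros z) (sym (ι-intros z)) ≈-refl) ≈-refl)) (ι-coe q)))))
  k : CCirc S (c + m) (c + n)
  k = iterate x h (suc ℓ) ⨾ (elims x ⊗ id (c + n))
  -- The next state; the remaining components, `w`, are the output.
  t = take c (eval I k (s ++ v))
  w = drop c (eval I k (s ++ v))
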